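{- Let $f\in\mathrm{TotP}$ and let $s:\mathbb{N}\to\mathbb{N}$ be a positive function with $s(n)=O(2^n)$. Then there is a deterministic algorithm which, on input $x\in\{0,1\}^n$ (given the value $s(n)$), decides whether $f(x)\le s(n)$ in time $O(s(n)\cdot\mathrm{poly}(n))$.
   Context: $\mathrm{TotP}$ is the class of functions $f:\{0,1\}^*\to\mathbb{N}$ for which there is a nondeterministic polynomial-time Turing machine $M$ such that for every input $x$ the number of all computation paths of $M$ on $x$ equals $f(x)+1$. Such an $M$ can be chosen binary (exactly two choices at each nondeterministic step), so that its computation tree on $x$ has exactly $f(x)$ internal nodes. -}

module Defs where

open import Data.Nat using (ℕ; zero; suc; _+_; _*_; _^_; _≤_; _<_)
open import Data.Nat.DivMod using (_/_; _%_)
open import Data.Bool using (Bool; true; false)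
open import Data.Fin using (Fin) renaming (zero to fz; suc to fs)
open import Data.List using (List; []; _∷_; _++_; map)
open import Data.Nat.ListAction using (sum)
open import Data.List.Relation.Unary.All using (All)
open import Data.Maybe using (Maybe; just; nothing)
open import Data.Product using (Σ; _×_; _,_)
open import Relation.Binary.PropositionalEquality using (_≡_)

-- Single-tape Turing machines (one-way infinite tape to the right).
-- Tape symbols of a machine with k extra symbols: Sym k = Fin (4 + k),
-- where 0 = blank, 1 = bit 0, 2 = bit 1, 3 = separator '#'.

Sym : ℕ → Set
Sym k = Fin (4 + k)

blank : ∀ {k} → Sym k
blank = fz

bitSym : ∀ {k} → Bool → Sym k
bitSym false = fs fz
bitSym true  = fs (fs fz)

sepSym : ∀ {k} → Sym k
sepSym = fs (fs (fs fz))

data Move : Set where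
  L R S : Move

-- Configuration: state, reversed contents left of the head,
-- the scanned symbol, contents right of the head.
record Config (Q k : ℕ) : Set where
  constructor conf
  field
    state : Fin Q
    left  : List (Sym k)
    head  : Sym k
    right : List (Sym k)

apply : ∀ {Q k} → Config Q k → Fin Q × Sym k × Move → Config Q k
apply (conf _ l _ r) (q , a , S) = conf q l a r
apply (conf _ [] _ r) (q , a , L) = conf q [] a r
apply (conf _ (b ∷ l) _ r) (q , a , L) = conf q l b (a ∷ r)
apply (conf _ l _ []) (q , a , R) = conf q (a ∷ l) blank []
apply (conf _ l _ (b ∷ r)) (q , a , R) = conf q (a ∷ l) b r

initConf : ∀ {Q k} → Fin Q → List (Sym k) → Config Q k
initConf q [] = conf q [] blank []
initConf q (a ∷ w) = conf q [] a w

bits : List Bool → ∀ {k} → List (Sym k)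
bits x = map bitSym x

-- Nondeterministic Turing machines.  A configuration is halting iff
-- the transition function offers no move.

record NTM : Set where
  field
    Q     : ℕ
    k     : ℕ
    start : Fin Q
    δ     : Fin Q → Sym k → List (Fin Q × Sym k × Move)

  succs : Config Q k → List (Config Q k)
  succs c = map (apply c) (δ (Config.state c) (Config.head c))

  HaltsWithin : ℕ → Config Q k → Set
  HaltsWithin zero    c = succs c ≡ []
  HaltsWithin (suc t) c = All (HaltsWithin t) (succs c)

  -- number of computation paths (leaves of the computation tree) from c,
  -- exploring to depth t (meaningful when HaltsWithin t c)
  paths : ℕ → Config Q k → ℕ
  paths t c = go t (succs c)
    where
    go : ℕ → List (Config Q k) → ℕ
    go _       []       = 1
    go zero    (_ ∷ _)  = 1
    go (suc t) (d ∷ ds) = sum (map (paths t) (d ∷ ds))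

  init : List Bool → Config Q k
  init x = initConf start (bits x)

poly : ℕ → ℕ → ℕ → ℕ
poly c e n = c * n ^ e + c

TotP : (List Bool → ℕ) → Set
TotP f = Σ NTM λ M → Σ ℕ λ c → Σ ℕ λ e →
  ((x : List Bool) → NTM.HaltsWithin M (poly c e (Data.List.length x)) (NTM.init M x))
  × ((x : List Bool) → NTM.paths M (poly c e (Data.List.length x)) (NTM.init M x) ≡ suc (f x))

record DTM : Set where
  field
    Q      : ℕ
    k      : ℕ
    start  : Fin Q
    δ      : Fin Q → Sym k → Maybe (Fin Q × Sym k × Move)
    accept : Fin Q → Bool

  step : Config Q k → Maybe (Config Q k)
  step c with δ (Config.state c) (Config.head c)
  ... | nothing = nothing
  ... | just tr = just (apply c tr)

  run : ℕ → Config Q k → Maybe (Config Q k)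
  run t c with step c
  ... | nothing = just c
  run zero c    | just _ = nothing
  run (suc t) c | just d = run t d

  initW : List (Sym k) → Config Q k
  initW w = initConf start w

-- Binary representation (least significant bit first; 0 ↦ empty list).

binaryFuel : ℕ → ℕ → List Bool
binaryFuel zero    _       = []
binaryFuel (suc f) zero    = []
binaryFuel (suc f) (suc m) = (((suc m) % 2) Data.Nat.≡ᵇ 1) ∷ binaryFuel f ((suc m) / 2)

binary : ℕ → List Bool
binary m = binaryFuel m m

encodePair : ∀ {k} → List Bool → ℕ → List (Sym k)
encodePair x m = bits x ++ (sepSym ∷ bits (binary m))

DecidesInTime : DTM → (List Bool → ℕ) → (ℕ → ℕ) → ℕ → ℕ → Set
DecidesInTime D f s c e = (x : List Bool) →
  let n = Data.List.length x in
  Σ ℕ λ t → t ≤ c * s n * (n ^ e + 1) ×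
  Σ (Config (DTM.Q D) (DTM.k D)) λ d →
    (DTM.run D t (DTM.initW D (encodePair x (s n))) ≡ just d) ×
    ((DTM.accept D (Config.state d) ≡ true → f x ≤ s n) ×
     (f x ≤ s n → DTM.accept D (Config.state d) ≡ true))

{-# OPTIONS --safe #-}

-- Walk depth first through the computation tree of M, undoing moves on the way back, and charge one
-- unit of a counter, initially s(n), for every alternative tried after the first at a node. A complete
-- walk is charged (number of leaves) − 1 = f(x), so the counter runs dry exactly when f(x) > s(n). As
-- every visited edge lies above one of the at most s(n) + 1 leaves reached, whose depth is polynomial,
-- O(s(n) · poly(n)) steps of a machine with five stacks suffice. Its stacks stay polynomially high
-- (the counter because s(n) = O(2ⁿ)), so a single tape simulates each step in polynomial time.

module Submission where

open import Defs
open import Data.Bool using (Bool; true; false; if_then_else_)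
open import Data.Fin using (Fin; toℕ) renaming (zero to fz; suc to fs)
import Data.Fin.Properties as Fin
open import Data.List using (List; []; _∷_; _++_; _ʳ++_; map; length; lookup; head; drop; reverse; concatMap; allFin)
open import Data.List.Membership.Propositional using (_∈_)
open import Data.List.Membership.Propositional.Properties using (∈-map⁺; ∈-allFin; ∈-concatMap⁺)
open import Data.List.Properties using (length-drop; length-map; length-++; length-reverse; reverse-involutive; map-∘)
open import Data.List.Relation.Unary.All as All using (All)
open import Data.List.Relation.Unary.Any as Any using (here; there; index)
open import Data.List.Relation.Unary.Any.Properties using (lookup-index)
open import Data.Maybe as Maybe using (Maybe; just; nothing)
open import Data.Nat using (ℕ; zero; suc; _+_; _*_; _^_; _≤_; _<_; _≡ᵇ_; z≤n; s≤s; s≤s⁻¹)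
open import Data.Nat.DivMod using (_/_; _%_; m%n<n; m≡m%n+[m/n]*n; m/n<m; m<n*o⇒m/o<n)
open import Data.Nat.ListAction using (sum)
open import Data.Nat.Properties
open import Data.Nat.Solver using (module +-*-Solver)
open import Data.Product using (Σ; ∃-syntax; _×_; _,_; proj₁; proj₂)
open import Data.Sum using (inj₁; inj₂)
open import Data.Unit using (⊤; tt)
open import Data.Vec as Vec using (Vec; []; _∷_) renaming (lookup to _!_; _[_]≔_ to _⟦_⟧≔_)
open import Data.Vec.Properties using (lookup∘update; lookup∘update′; lookup-replicate)
import Data.Vec.Relation.Unary.All as VecAll
open import Data.Vec.Relation.Unary.All.Properties using (lookup⁺)
open import Function using (_∘_)
open import Relation.Binary.PropositionalEquality
open import Relation.Nullary using (yes; no; contradiction)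

-- The machine has no clock and does not know the polynomial bounding the depth of `M`. Depth, stack
-- height and time enter only through the analysis, so the height `H` indexes the run relation and
-- is no part of the machine. A node is remembered by one symbol from a finite alphabet (state,
-- scanned symbol, next alternative, how to undo the move) and never by a copy of the configuration,
-- so an edge costs a few stack operations and at most one decrement. A node with m alternatives is
-- charged at most m - 1, and over a finite tree of any branching the numbers m - 1 sum to the
-- number of leaves minus one. The delicate case is a walk that is cut short. The whole tree may
-- have far more than s(n) leaves, so time must be measured by the leaves reached before the counter
-- runs dry. The induction on depth gives every leaf a rate that grows by one edge cost per level,
-- and a walk abandoned with allowance v is bounded by v + 1 times that rate.

-- Finite types by enumeration

record Finite (A : Set) : Set where
  constructor finite
  field
    elements : List A
    complete : ∀ a → a ∈ elements

open Finite

fin-⊤ : Finite ⊤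
fin-⊤ = finite (tt ∷ []) λ _ → here refl

fin-Bool : Finite Bool
fin-Bool = finite (true ∷ false ∷ []) λ { true → here refl ; false → there (here refl) }

fin-Fin : ∀ {n} → Finite (Fin n)
fin-Fin {n} = finite (allFin n) ∈-allFin

fin-Maybe : ∀ {A} → Finite A → Finite (Maybe A)
fin-Maybe F = finite (nothing ∷ map just (elements F)) λ
  { nothing → here refl ; (just a) → there (∈-map⁺ just (complete F a)) }

fin-Σ : ∀ {A} {B : A → Set} → Finite A → (∀ a → Finite (B a)) → Finite (Σ A B)
fin-Σ {A} {B} F G = finite (concatMap fibre (elements F)) λ
  { (a , b) → ∈-concatMap⁺ fibre (Any.map (λ { refl → ∈-map⁺ (a ,_) (complete (G a) b) }) (complete F a)) }
  where
  fibre : A → List (Σ A B)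
  fibre a = map (a ,_) (elements (G a))

fin-× : ∀ {A B} → Finite A → Finite B → Finite (A × B)
fin-× F G = fin-Σ F λ _ → G

fin-Vec : ∀ {A} n → Finite A → Finite (Vec A n)
fin-Vec zero F = finite ([] ∷ []) λ { [] → here refl }
fin-Vec {A} (suc n) F = finite (map cons (elements FV)) λ { (a ∷ v) → ∈-map⁺ cons (complete FV (a , v)) }
  where
  FV : Finite (A × Vec A n)
  FV = fin-× F (fin-Vec n F)
  cons : A × Vec A n → Vec A (suc n)
  cons (a , v) = a ∷ v

fin-cover : ∀ {B} (cs : List (Σ Set λ A → Finite A × (A → B))) →
            (∀ b → Any.Any (λ (A , F , f) → ∃[ a ] f a ≡ b) cs) → Finite B
fin-cover {B} cs cover = finite (concatMap images cs) λ b →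
  ∈-concatMap⁺ images (Any.map (λ {AFf} → image b AFf) (cover b))
  where
  images : (Σ Set λ A → Finite A × (A → B)) → List B
  images (A , F , f) = map f (elements F)
  image : ∀ b AFf → (let (A , F , f) = AFf in ∃[ a ] f a ≡ b) → b ∈ images AFf
  image _ (A , F , f) (a , refl) = ∈-map⁺ f (complete F a)

-- Tape machines over arbitrary finite types

record Tape (State Cell : Set) : Set where
  constructor tape
  field
    state : State
    left  : List Cell
    scan  : Cell
    right : List Cell

record TapeMachine : Set₁ where
  field
    State Cell      : Set
    finState        : Finite State
    finCell         : Finite Cell
    start           : State
    blankCell       : Cell
    bitCell         : Bool → Cell
    sepCell         : Cell
    δ               : State → Cell → Maybe (State × Cell × Move)
    accepting       : State → Bool

  move : Tape State Cell → State × Cell × Move → Tape State Cell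
  move (tape _ l _ r) (q , a , S) = tape q l a r
  move (tape _ [] _ r) (q , a , L) = tape q [] a r
  move (tape _ (b ∷ l) _ r) (q , a , L) = tape q l b (a ∷ r)
  move (tape _ l _ []) (q , a , R) = tape q (a ∷ l) blankCell []
  move (tape _ l _ (b ∷ r)) (q , a , R) = tape q (a ∷ l) b r

  -- The index is an upper bound on the number of steps, since `done` holds at every index. Runs can
  -- thus be composed and padded without computing exact times.
  data Reach : ℕ → Tape State Cell → Tape State Cell → Set where
    done : ∀ {n c} → Reach n c c
    step : ∀ {n c d tr} → δ (Tape.state c) (Tape.scan c) ≡ just tr →
           Reach n (move c tr) d → Reach (suc n) c d

  reach-≤ : ∀ {m n c d} → m ≤ n → Reach m c d → Reach n c d
  reach-≤ _ done = done
  reach-≤ (s≤s m≤n) (step eq r) = step eq (reach-≤ m≤n r)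

  reach-++ : ∀ {m n c d e} → Reach m c d → Reach n d e → Reach (m + n) c e
  reach-++ {m} {n} done r′ = reach-≤ (m≤n+m n m) r′
  reach-++ (step eq r) r′ = step eq (reach-++ r r′)

  private
    states : List State
    states = elements finState
    cells : List Cell
    cells = elements finCell

  encState : State → Fin (length states)
  encState q = index (complete finState q)

  decState : Fin (length states) → State
  decState = lookup states

  encCell : Cell → Sym (length cells)
  encCell a = fs (fs (fs (fs (index (complete finCell a)))))

  decCell : Sym (length cells) → Cell
  decCell = lookup (blankCell ∷ bitCell false ∷ bitCell true ∷ sepCell ∷ cells)

  decState∘encState : ∀ q → decState (encState q) ≡ q
  decState∘encState q = sym (lookup-index (complete finState q))

  decCell∘encCell : ∀ a → decCell (encCell a) ≡ a
  decCell∘encCell a = sym (lookup-index (complete finCell a))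

  encTrans : State × Cell × Move → Fin (length states) × Sym (length cells) × Move
  encTrans (q , a , m) = encState q , encCell a , m

  toDTM : DTM
  toDTM = record
    { Q = length states ; k = length cells ; start = encState start
    ; δ = λ q a → Maybe.map encTrans (δ (decState q) (decCell a))
    ; accept = accepting ∘ decState }

  private module D = DTM toDTM

  -- The simulation is stated through decoding because codes are not unique: enumerations may
  -- repeat, and blank, bits and separator have one code fixed by `Sym` and another inside `cells`,
  -- which is the one the machine writes.
  decode : Config D.Q D.k → Tape State Cell
  decode (conf q l a r) = tape (decState q) (map decCell l) (decCell a) (map decCell r)

  decode-apply : ∀ c tr → decode (apply c (encTrans tr)) ≡ move (decode c) tr
  decode-apply (conf _ l _ r) (q , a , S) rewrite decState∘encState q | decCell∘encCell a = refl
  decode-apply (conf _ [] _ r) (q , a , L) rewrite decState∘encState q | decCell∘encCell a = refl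
  decode-apply (conf _ (b ∷ l) _ r) (q , a , L) rewrite decState∘encState q | decCell∘encCell a = refl
  decode-apply (conf _ l _ []) (q , a , R) rewrite decState∘encState q | decCell∘encCell a = refl
  decode-apply (conf _ l _ (b ∷ r)) (q , a , R) rewrite decState∘encState q | decCell∘encCell a = refl

  -- Surplus fuel does no harm: `run` returns as soon as no transition applies, so an upper bound on
  -- the time serves as fuel.
  run-reach : ∀ {n c d} C → decode C ≡ c → Reach n c d → δ (Tape.state d) (Tape.scan d) ≡ nothing →
              ∃[ C′ ] D.run n C ≡ just C′ × decode C′ ≡ d
  run-reach {n} C refl done eq = C , halted n , refl
    where
    halted : ∀ n → D.run n C ≡ just C
    halted n rewrite eq = refl
  run-reach {suc n} C refl (step {tr = tr} eq r) eq′ rewrite eq =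
    run-reach (apply C (encTrans tr)) (decode-apply C tr) r eq′

-- Stack machines

-- Unlike `2 * n`, this unfolds by two successors per element, so the step out and the step back
-- match the index of `Reach` definitionally.
double : ℕ → ℕ
double zero = zero
double (suc n) = suc (suc (double n))

double≡+ : ∀ n → double n ≡ n + n
double≡+ zero = refl
double≡+ (suc n) = cong suc (trans (cong suc (double≡+ n)) (sym (+-suc n n)))

double-mono : ∀ {m n} → m ≤ n → double m ≤ double n
double-mono z≤n = z≤n
double-mono (s≤s m≤n) = s≤s (s≤s (double-mono m≤n))

-- The tape has one track per stack, with the top of each stack in cell 0, which carries a mark.
-- A pop walks right to the end of its track and shifts the track left on the way back; a push
-- shifts its track right on the way out.
record StackMachine : Set₁ where
  field
    State Symbol : Set
    finState     : Finite State
    finSymbol    : Finite Symbol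
    K            : ℕ
    start        : State
    bitSymbol    : Bool → Symbol
    sepSymbol    : Symbol
    halted       : State → Bool
    source       : State → Fin (suc K)
    control      : State → Maybe Symbol → Maybe (Fin (suc K) × Symbol) × State
    accepting    : State → Bool

  Stacks : Set
  Stacks = Vec (List Symbol) (suc K)

  push : Maybe (Fin (suc K) × Symbol) → Stacks → Stacks
  push nothing σ = σ
  push (just (j , a)) σ = σ ⟦ j ⟧≔ (a ∷ σ ! j)

  -- Every step pops its source stack, even when the control ignores the symbol. Nothing is lost if
  -- that stack is empty.
  next : State × Stacks → State × Stacks
  next (p , σ) with control p (head (σ ! source p))
  ... | w , p′ = p′ , push w (σ ⟦ source p ⟧≔ drop 1 (σ ! source p))

  Bounded : ℕ → Stacks → Set
  Bounded H = VecAll.All (λ s → length s ≤ H)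

  data Reach (H : ℕ) : ℕ → State × Stacks → State × Stacks → Set where
    done : ∀ {n c} → Reach H n c c
    step : ∀ {n p σ d} → halted p ≡ false → Bounded H σ →
           Reach H n (next (p , σ)) d → Reach H (suc n) (p , σ) d

  reach-≤ : ∀ {H m n c d} → m ≤ n → Reach H m c d → Reach H n c d
  reach-≤ _ done = done
  reach-≤ (s≤s m≤n) (step h b r) = step h b (reach-≤ m≤n r)

  reach-++ : ∀ {H m n c d e} → Reach H m c d → Reach H n d e → Reach H (m + n) c e
  reach-++ {m = m} {n} done r′ = reach-≤ (m≤n+m n m) r′
  reach-++ (step h b r) r′ = step h b (reach-++ r r′)

  -- Stacks as tracks of a single tape

  data Phase : Set where
    boot    : Phase
    at      : State → Phase
    popping : State → Maybe Symbol → Phase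
    pushing : Fin (suc K) → Symbol → State → Phase
    return  : State → Phase

  Column : Set
  Column = Vec (Maybe Symbol) (suc K)

  Cell : Set
  Cell = Bool × Column

  empty : Column
  empty = Vec.replicate (suc K) nothing

  inputCell : Symbol → Cell
  inputCell a = false , just a ∷ Vec.replicate K nothing

  finPhase : Finite Phase
  finPhase = fin-cover
    ( (_ , fin-⊤ , λ _ → boot) ∷ (_ , finState , at)
    ∷ (_ , fin-× finState (fin-Maybe finSymbol) , λ (p , m) → popping p m)
    ∷ (_ , fin-× fin-Fin (fin-× finSymbol finState) , λ (j , a , p) → pushing j a p)
    ∷ (_ , finState , return) ∷ [])
    λ { boot → here (_ , refl)
      ; (at p) → there (here (p , refl))
      ; (popping p m) → there (there (here ((p , m) , refl)))
      ; (pushing j a p) → there (there (there (here ((j , a , p) , refl))))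
      ; (return p) → there (there (there (there (here (p , refl))))) }

  finish : Maybe (Fin (suc K) × Symbol) × State → Phase
  finish (nothing , p) = at p
  finish (just (j , a) , p) = pushing j a p

  walk : State → Cell → Maybe Symbol → Phase × Cell × Move
  walk p c (just _) = at p , c , R
  -- On the marked cell a left move leaves the head in place. The machine could not notice this by
  -- itself, which is why cell 0 needs the mark.
  walk p (true , v) nothing = finish (control p nothing) , (true , v) , L
  walk p (false , v) nothing = popping p nothing , (false , v) , L

  transition : Phase → Cell → Maybe (Phase × Cell × Move)
  transition boot (_ , v) = just (at start , (true , v) , S)
  transition (at p) (b , v) =
    if halted p then nothing else just (walk p (b , v) (v ! source p))
  transition (popping p m) (b , v) =
    just ((if b then finish (control p (v ! source p)) else popping p (v ! source p))
         , (b , v ⟦ source p ⟧≔ m) , L)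
  transition (pushing j a p) (b , v) with v ! j
  ... | nothing = just (return p , (b , v ⟦ j ⟧≔ just a) , L)
  ... | just a′ = just (pushing j a′ p , (b , v ⟦ j ⟧≔ just a) , R)
  transition (return p) (true , v) = just (at p , (true , v) , L)
  transition (return p) (false , v) = just (return p , (false , v) , L)

  toTape : TapeMachine
  toTape = record
    { State = Phase ; Cell = Cell
    ; finState = finPhase
    ; finCell = fin-× fin-Bool (fin-Vec (suc K) (fin-Maybe finSymbol))
    ; start = boot
    ; blankCell = false , empty
    ; bitCell = λ b → inputCell (bitSymbol b)
    ; sepCell = inputCell sepSymbol
    ; δ = transition
    ; accepting = λ { (at p) → accepting p ; _ → false } }

  module T = TapeMachine toTape

  unmarked : List Column → List Cell
  unmarked = map (false ,_)

  -- The columns may outlast the stack, since other tracks can be longer. Below its last symbol the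
  -- track then has to read `nothing`, as does the blank tape after the last column.
  Track : Fin (suc K) → List Column → List Symbol → Set
  Track j [] s = s ≡ []
  Track j (v ∷ cs) s = v ! j ≡ head s × Track j cs (drop 1 s)

  track-empty : ∀ j {s} → Track j [] s → Track j (empty ∷ []) s
  track-empty j refl = lookup-replicate j nothing , refl

  -- The frame condition of a walk. It speaks of contents and not of columns, because a walk may
  -- lengthen the written tape.
  Others : Fin (suc K) → List Column → List Column → Set
  Others j cs cs′ = ∀ i → i ≢ j → ∀ s → Track i cs s → Track i cs′ s

  others-∷ : ∀ {j} v m {cs cs′} → Others j cs cs′ → Others j (v ∷ cs) ((v ⟦ j ⟧≔ m) ∷ cs′)
  others-∷ v m oth i i≢j s (eq , tr) = trans (lookup∘update′ i≢j v m) eq , oth i i≢j (drop 1 s) tr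

  others-[] : ∀ {j cs} → Others j (empty ∷ []) cs → Others j [] cs
  others-[] oth i i≢j s tr = oth i i≢j s (track-empty i tr)

  reach-snoc : ∀ {n c d tr} → T.Reach n c d → transition (Tape.state d) (Tape.scan d) ≡ just tr →
               T.Reach (suc n) c (T.move d tr)
  reach-snoc {n} r eq =
    T.reach-≤ (≤-reflexive (+-comm n 1)) (T.reach-++ r (T.step eq (T.done {n = 0})))

  PopWalk : State → List Symbol → Column → List Column → List Cell → Cell → Set
  PopWalk p s v cs l c = ∃[ cs′ ]
    T.Reach (suc (double (length s)))
      (tape (at p) (c ∷ l) (false , v) (unmarked cs)) (tape (popping p (head s)) l c (unmarked cs′))
    × Track (source p) cs′ (drop 1 s) × Others (source p) (v ∷ cs) cs′

  module _ (p : State) (running : halted p ≡ false) where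

    forward : ∀ {b v a} → v ! source p ≡ just a → transition (at p) (b , v) ≡ just (at p , (b , v) , R)
    forward eq rewrite running | eq = refl

    -- Induction on the part of the stack from this cell on. The walk returns to the cell on the
    -- left carrying the top of that part, which is exactly the symbol to be written there.
    pop-walk : ∀ s v cs l c → Track (source p) (v ∷ cs) s → PopWalk p s v cs l c
    pop-walk [] v cs l c tr@(eq , _) = v ∷ cs , T.step turn T.done , tr , λ _ _ _ t → t
      where
      turn : transition (at p) (false , v) ≡ just (popping p nothing , (false , v) , L)
      turn rewrite running | eq = refl
    pop-walk (a ∷ s) v cs l c (eq , tr) = beyond cs tr
      where
      backward : transition (popping p (head s)) (false , v)
               ≡ just (popping p (just a) , (false , v ⟦ source p ⟧≔ head s) , L)
      backward rewrite eq = refl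
      beyond : ∀ cs → Track (source p) cs s → PopWalk p (a ∷ s) v cs l c
      -- The move right leaves the written tape and creates a blank column.
      beyond [] tr with pop-walk s empty [] (c ∷ l) (false , v) (track-empty (source p) tr)
      ... | cs′ , r , tr′ , oth =
        (v ⟦ source p ⟧≔ head s) ∷ cs′ , T.step (forward eq) (reach-snoc r backward)
        , (lookup∘update (source p) v (head s) , tr′) , others-∷ v (head s) (others-[] oth)
      beyond (v′ ∷ cs) tr with pop-walk s v′ cs (c ∷ l) (false , v) tr
      ... | cs′ , r , tr′ , oth =
        (v ⟦ source p ⟧≔ head s) ∷ cs′ , T.step (forward eq) (reach-snoc r backward)
        , (lookup∘update (source p) v (head s) , tr′) , others-∷ v (head s) {v′ ∷ cs} oth

  PushWalk : Fin (suc K) → Symbol → State → List Symbol → Column → List Column → List Cell → Cell → Set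
  PushWalk j a p s v cs l c = ∃[ cs′ ]
    T.Reach (suc (double (length s)))
      (tape (pushing j a p) (c ∷ l) (false , v) (unmarked cs)) (tape (return p) l c (unmarked cs′))
    × Track j cs′ (a ∷ s) × Others j (v ∷ cs) cs′

  turn-push : ∀ {j p b v a} → v ! j ≡ nothing →
              transition (pushing j a p) (b , v) ≡ just (return p , (b , v ⟦ j ⟧≔ just a) , L)
  turn-push eq rewrite eq = refl

  carry-push : ∀ {j p b v a a′} → v ! j ≡ just a′ →
               transition (pushing j a p) (b , v) ≡ just (pushing j a′ p , (b , v ⟦ j ⟧≔ just a) , R)
  carry-push eq rewrite eq = refl

  push-walk : ∀ j a p s v cs l c → Track j (v ∷ cs) s → PushWalk j a p s v cs l c
  push-walk j a p [] v cs l c (eq , tr) =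
    (v ⟦ j ⟧≔ just a) ∷ cs , T.step (turn-push eq) T.done
    , (lookup∘update j v (just a) , tr) , others-∷ v (just a) {cs} (λ _ _ _ t → t)
  push-walk j a p (b ∷ s) v cs l c (eq , tr) = beyond cs tr
    where
    beyond : ∀ cs → Track j cs s → PushWalk j a p (b ∷ s) v cs l c
    beyond [] tr with push-walk j b p s empty [] (c ∷ l) (false , v ⟦ j ⟧≔ just a) (track-empty j tr)
    ... | cs′ , r , tr′ , oth =
      (v ⟦ j ⟧≔ just a) ∷ cs′ , T.step (carry-push eq) (reach-snoc r refl)
      , (lookup∘update j v (just a) , tr′) , others-∷ v (just a) (others-[] oth)
    beyond (v′ ∷ cs) tr with push-walk j b p s v′ cs (c ∷ l) (false , v ⟦ j ⟧≔ just a) tr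
    ... | cs′ , r , tr′ , oth =
      (v ⟦ j ⟧≔ just a) ∷ cs′ , T.step (carry-push eq) (reach-snoc r refl)
      , (lookup∘update j v (just a) , tr′) , others-∷ v (just a) {v′ ∷ cs} oth

  Represents : List Column → Stacks → Set
  Represents cs σ = ∀ i → Track i cs (σ ! i)

  represents-update : ∀ cs cs′ σ {j s} → Represents cs σ → Track j cs′ s → Others j cs cs′ →
                      Represents cs′ (σ ⟦ j ⟧≔ s)
  represents-update cs cs′ σ {j} {s} rep tr oth i with i Fin.≟ j
  ... | yes refl = subst (Track i cs′) (sym (lookup∘update i σ s)) tr
  ... | no i≢j = subst (Track i cs′) (sym (lookup∘update′ i≢j σ s)) (oth i i≢j (σ ! i) (rep i))

  home : Phase → Column → List Column → Tape Phase Cell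
  home q v cs = tape q [] (true , v) (unmarked cs)

  PopHome : State → List Symbol → Column → List Column → Set
  PopHome p s v cs = ∃[ v′ ] ∃[ cs′ ]
    T.Reach (suc (double (length s))) (home (at p) v cs) (home (finish (control p (head s))) v′ cs′)
    × Track (source p) (v′ ∷ cs′) (drop 1 s) × Others (source p) (v ∷ cs) (v′ ∷ cs′)

  pop-home : ∀ p → halted p ≡ false → ∀ s v cs → Track (source p) (v ∷ cs) s → PopHome p s v cs
  pop-home p running [] v cs tr@(eq , _) = v , cs , T.step stop T.done , tr , λ _ _ _ t → t
    where
    stop : transition (at p) (true , v) ≡ just (finish (control p nothing) , (true , v) , L)
    stop rewrite running | eq = refl
  pop-home p running (a ∷ s) v cs (eq , tr) = beyond cs tr
    where
    arrive : transition (popping p (head s)) (true , v)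
           ≡ just (finish (control p (just a)) , (true , v ⟦ source p ⟧≔ head s) , L)
    arrive rewrite eq = refl
    beyond : ∀ cs → Track (source p) cs s → PopHome p (a ∷ s) v cs
    beyond [] tr with pop-walk p running s empty [] [] (true , v) (track-empty (source p) tr)
    ... | cs′ , r , tr′ , oth =
      v ⟦ source p ⟧≔ head s , cs′ , T.step (forward p running eq) (reach-snoc r arrive)
      , (lookup∘update (source p) v (head s) , tr′) , others-∷ v (head s) (others-[] oth)
    beyond (v′ ∷ cs) tr with pop-walk p running s v′ cs [] (true , v) tr
    ... | cs′ , r , tr′ , oth =
      v ⟦ source p ⟧≔ head s , cs′ , T.step (forward p running eq) (reach-snoc r arrive)
      , (lookup∘update (source p) v (head s) , tr′) , others-∷ v (head s) {v′ ∷ cs} oth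

  PushHome : Fin (suc K) → Symbol → State → List Symbol → Column → List Column → Set
  PushHome j a p s v cs = ∃[ v′ ] ∃[ cs′ ]
    T.Reach (suc (suc (double (length s)))) (home (pushing j a p) v cs) (home (at p) v′ cs′)
    × Track j (v′ ∷ cs′) (a ∷ s) × Others j (v ∷ cs) (v′ ∷ cs′)

  push-home : ∀ j a p s v cs → Track j (v ∷ cs) s → PushHome j a p s v cs
  push-home j a p [] v cs (eq , tr) =
    v ⟦ j ⟧≔ just a , cs , T.step (turn-push eq) (T.step refl T.done)
    , (lookup∘update j v (just a) , tr) , others-∷ v (just a) {cs} (λ _ _ _ t → t)
  push-home j a p (b ∷ s) v cs (eq , tr) = beyond cs tr
    where
    beyond : ∀ cs → Track j cs s → PushHome j a p (b ∷ s) v cs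
    beyond [] tr with push-walk j b p s empty [] [] (true , v ⟦ j ⟧≔ just a) (track-empty j tr)
    ... | cs′ , r , tr′ , oth =
      -- The spare step in the bound is for the empty stack: there the head never leaves home, and
      -- both the write and the return step happen on the marked cell.
      v ⟦ j ⟧≔ just a , cs′ , T.reach-≤ (n≤1+n _) (T.step (carry-push eq) (reach-snoc r refl))
      , (lookup∘update j v (just a) , tr′) , others-∷ v (just a) (others-[] oth)
    beyond (v′ ∷ cs) tr with push-walk j b p s v′ cs [] (true , v ⟦ j ⟧≔ just a) tr
    ... | cs′ , r , tr′ , oth =
      v ⟦ j ⟧≔ just a , cs′ , T.reach-≤ (n≤1+n _) (T.step (carry-push eq) (reach-snoc r refl))
      , (lookup∘update j v (just a) , tr′) , others-∷ v (just a) {v′ ∷ cs} oth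

  cost : ℕ → ℕ
  cost H = suc (double H) + suc (suc (double H))

  bounded-drop : ∀ {H} σ j i → Bounded H σ → length ((σ ⟦ j ⟧≔ drop 1 (σ ! j)) ! i) ≤ H
  bounded-drop σ j i bnd with i Fin.≟ j
  ... | yes refl rewrite lookup∘update i σ (drop 1 (σ ! i)) | length-drop 1 (σ ! i) =
    ≤-trans (m∸n≤m _ 1) (lookup⁺ bnd i)
  ... | no i≢j rewrite lookup∘update′ i≢j σ (drop 1 (σ ! j)) = lookup⁺ bnd i

  simulate-step : ∀ {H} p σ v cs → halted p ≡ false → Bounded H σ → Represents (v ∷ cs) σ →
    ∃[ v′ ] ∃[ cs′ ] T.Reach (cost H) (home (at p) v cs) (home (at (proj₁ (next (p , σ)))) v′ cs′)
                   × Represents (v′ ∷ cs′) (proj₂ (next (p , σ)))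
  simulate-step {H} p σ v cs running bnd rep with pop-home p running (σ ! source p) v cs (rep (source p))
  ... | v₁ , cs₁ , r , tr , oth with control p (head (σ ! source p))
                                   | T.reach-≤ (s≤s (double-mono (lookup⁺ bnd (source p)))) r
                                   | represents-update (v ∷ cs) (v₁ ∷ cs₁) σ rep tr oth
  ... | nothing , p′ | r′ | rep₁ = v₁ , cs₁ , T.reach-≤ (m≤m+n _ _) r′ , rep₁
  ... | just (j , a) , p′ | r′ | rep₁ with push-home j a p′ _ v₁ cs₁ (rep₁ j)
  ... | v₂ , cs₂ , r₂ , tr₂ , oth₂ =
    v₂ , cs₂
    , T.reach-++ r′ (T.reach-≤ (s≤s (s≤s (double-mono (bounded-drop σ (source p) j bnd)))) r₂)
    , represents-update (v₁ ∷ cs₁) (v₂ ∷ cs₂) (σ ⟦ source p ⟧≔ drop 1 (σ ! source p)) rep₁ tr₂ oth₂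

  simulate : ∀ {H n p σ d} v cs → Reach H n (p , σ) d → Represents (v ∷ cs) σ →
    ∃[ v′ ] ∃[ cs′ ] T.Reach (n * cost H) (home (at p) v cs) (home (at (proj₁ d)) v′ cs′)
  simulate v cs done rep = v , cs , T.done
  simulate v cs (step {p = p} {σ} running bnd r) rep with simulate-step p σ v cs running bnd rep
  ... | v₁ , cs₁ , r₁ , rep₁ with simulate v₁ cs₁ r rep₁
  ... | v₂ , cs₂ , r₂ = v₂ , cs₂ , T.reach-++ r₁ r₂

  column : Symbol → Column
  column a = just a ∷ Vec.replicate K nothing

  initial : List Symbol → Stacks
  initial w = w ∷ Vec.replicate K []

  track-column : ∀ w i {s} → s ≡ [] → Track (fs i) (map column w) s
  track-column [] i eq = eq
  track-column (a ∷ w) i refl = lookup-replicate i nothing , track-column w i refl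

  track-input : ∀ w → Track fz (map column w) w
  track-input [] = refl
  track-input (a ∷ w) = refl , track-input w

  -- An input cell decodes to a column occupied on track 0 alone, so the untouched input already is
  -- stack 0 with its first symbol on top. Booting only has to set the mark.
  represents-initial : ∀ w → Represents (map column w) (initial w)
  represents-initial w fz = track-input w
  represents-initial w (fs i) = track-column w i (lookup-replicate i [])

  input : List Bool → ℕ → List Symbol
  input x m = map bitSymbol x ++ sepSymbol ∷ map bitSymbol (binary m)

  decode-bits : ∀ x → map T.decCell (bits x) ≡ unmarked (map column (map bitSymbol x))
  decode-bits [] = refl
  decode-bits (true ∷ x) = cong (_ ∷_) (decode-bits x)
  decode-bits (false ∷ x) = cong (_ ∷_) (decode-bits x)

  decode-encodePair : ∀ x m → map T.decCell (encodePair x m) ≡ unmarked (map column (input x m))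
  decode-encodePair [] m = cong (_ ∷_) (decode-bits (binary m))
  decode-encodePair (true ∷ x) m = cong (_ ∷_) (decode-encodePair x m)
  decode-encodePair (false ∷ x) m = cong (_ ∷_) (decode-encodePair x m)

  input≢[] : ∀ x {m} → input x m ≢ []
  input≢[] [] ()
  input≢[] (_ ∷ _) ()

  decode-initConf : ∀ {v cs} w → map T.decCell w ≡ unmarked (v ∷ cs) →
                    T.decode (initConf (DTM.start T.toDTM) w) ≡ tape boot [] (false , v) (unmarked cs)
  decode-initConf {v} {cs} (a ∷ w) eq with map T.decCell w | T.decCell a
  decode-initConf {v} {cs} (a ∷ w) refl | _ | _ =
    cong (λ q → tape q [] (false , v) (unmarked cs)) (T.decState∘encState boot)

  Runs : (D : DTM) → State → ℕ → List (Sym (DTM.k D)) → Set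
  Runs D p t w = ∃[ C ] DTM.run D t (DTM.initW D w) ≡ just C × DTM.accept D (Config.state C) ≡ accepting p

  runs : ∀ {H n p σ} u w → u ≢ [] → map T.decCell w ≡ unmarked (map column u) →
         Reach H n (start , initial u) (p , σ) → halted p ≡ true → Runs T.toDTM p (suc (n * cost H)) w
  runs [] w u≢[] eq r stopped = contradiction refl u≢[]
  runs {p = p} (a ∷ u) w _ eq r stopped
    with simulate (column a) (map column u) r (represents-initial (a ∷ u))
  ... | v , cs , r′ with T.run-reach (initConf (DTM.start T.toDTM) w) (decode-initConf w eq) (T.step refl r′) finished
    where
    finished : transition (at p) (true , v) ≡ nothing
    finished rewrite stopped = refl
  ... | C , run≡ , decode≡ = C , run≡ , cong (λ c → TapeMachine.accepting toTape (Tape.state c)) decode≡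

  -- Abstract, because the normal form of this machine is enormous.
  abstract
    compile : Σ DTM λ D → ∀ {H n p σ} x m → Reach H n (start , initial (input x m)) (p , σ) →
              halted p ≡ true → Runs D p (suc (n * cost H)) (encodePair x m)
    compile = T.toDTM , λ x m → runs (input x m) (encodePair x m) (input≢[] x) (decode-encodePair x m)

-- Binary numerals and polynomial bounds

val : List Bool → ℕ
val [] = 0
val (true ∷ bs) = suc (2 * val bs)
val (false ∷ bs) = 2 * val bs

binaryFuel-length : ∀ f m w → m < 2 ^ w → length (binaryFuel f m) ≤ w
binaryFuel-length zero m w _ = z≤n
binaryFuel-length (suc f) zero w _ = z≤n
binaryFuel-length (suc f) (suc m) zero (s≤s ())
binaryFuel-length (suc f) (suc m) (suc w) m< =
  s≤s (binaryFuel-length f (suc m / 2) w (m<n*o⇒m/o<n (<-≤-trans m< (≤-reflexive (*-comm 2 (2 ^ w))))))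

val-∷ : ∀ r bs → r < 2 → val ((r ≡ᵇ 1) ∷ bs) ≡ r + val bs * 2
val-∷ 0 bs _ = *-comm 2 (val bs)
val-∷ 1 bs _ = cong suc (*-comm 2 (val bs))
val-∷ (suc (suc _)) bs (s≤s (s≤s ()))

val-binaryFuel : ∀ f m → m ≤ f → val (binaryFuel f m) ≡ m
val-binaryFuel zero zero _ = refl
val-binaryFuel (suc f) zero _ = refl
val-binaryFuel (suc f) (suc m) m≤f = begin
  val ((suc m % 2 ≡ᵇ 1) ∷ binaryFuel f (suc m / 2))  ≡⟨ val-∷ (suc m % 2) _ (m%n<n (suc m) 2) ⟩
  suc m % 2 + val (binaryFuel f (suc m / 2)) * 2     ≡⟨ cong (λ v → suc m % 2 + v * 2) ih ⟩
  suc m % 2 + suc m / 2 * 2                          ≡⟨ m≡m%n+[m/n]*n (suc m) 2 ⟨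
  suc m                                              ∎
  where
  open ≡-Reasoning
  ih : val (binaryFuel f (suc m / 2)) ≡ suc m / 2
  ih = val-binaryFuel f (suc m / 2) (s≤s⁻¹ (<-≤-trans (m/n<m (suc m) 2 (s≤s (s≤s z≤n))) m≤f))

n<2^n : ∀ n → n < 2 ^ n
n<2^n zero = s≤s z≤n
n<2^n (suc n) = +-mono-≤ (m^n>0 2 n) (≤-trans (n<2^n n) (≤-reflexive (sym (+-identityʳ (2 ^ n)))))

-- Finitely many exceptions to an O(2ⁿ) bound are absorbed by a larger shift of the exponent.
exponential-shift : (s : ℕ → ℕ) → (∃[ c ] ∃[ n₀ ] ∀ n → n₀ ≤ n → s n ≤ c * 2 ^ n) →
                    ∃[ C ] ∀ n → s n < 2 ^ (n + C)
exponential-shift s (c , n₀ , big) = c + below n₀ , bound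
  where
  below : ℕ → ℕ
  below zero = 0
  below (suc m) = s m + below m
  s≤below : ∀ m n → n < m → s n ≤ below m
  s≤below (suc m) n n<m with m≤n⇒m<n∨m≡n (s≤s⁻¹ n<m)
  ... | inj₁ n<m′ = ≤-trans (s≤below m n n<m′) (m≤n+m _ (s m))
  ... | inj₂ refl = m≤m+n (s n) _
  bound : ∀ n → s n < 2 ^ (n + (c + below n₀))
  bound n with n₀ ≤? n
  ... | yes n₀≤n = begin-strict
    s n                          ≤⟨ big n n₀≤n ⟩
    c * 2 ^ n                    <⟨ *-monoˡ-< (2 ^ n) {{m^n≢0 2 n}} (n<2^n c) ⟩
    2 ^ c * 2 ^ n                ≡⟨ ^-distribˡ-+-* 2 c n ⟨
    2 ^ (c + n)                  ≤⟨ ^-monoʳ-≤ 2 (≤-trans (≤-reflexive (+-comm c n)) (+-monoʳ-≤ n (m≤m+n c _))) ⟩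
    2 ^ (n + (c + below n₀))     ∎
    where open ≤-Reasoning
  ... | no n₀≰n = begin-strict
    s n                          ≤⟨ s≤below n₀ n (≰⇒> n₀≰n) ⟩
    below n₀                     <⟨ n<2^n (below n₀) ⟩
    2 ^ below n₀                 ≤⟨ ^-monoʳ-≤ 2 (≤-trans (m≤n+m _ c) (m≤n+m _ n)) ⟩
    2 ^ (n + (c + below n₀))     ∎
    where open ≤-Reasoning

PolynomiallyBounded : (ℕ → ℕ) → Set
PolynomiallyBounded g = ∃[ C ] ∃[ e ] ∀ n → g n ≤ C * (n ^ e + 1)

pb-≤ : ∀ {g h} → (∀ n → g n ≤ h n) → PolynomiallyBounded h → PolynomiallyBounded g
pb-≤ g≤h (C , e , h≤) = C , e , λ n → ≤-trans (g≤h n) (h≤ n)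

pb-const : ∀ k → PolynomiallyBounded (λ _ → k)
pb-const k = k , 0 , λ n → ≤-trans (m≤m+n k (k + 0)) (≤-reflexive (*-comm 2 k))

pb-id : PolynomiallyBounded (λ n → n)
pb-id = 1 , 1 , λ n → ≤-trans (m≤m+n n 1) (≤-reflexive
  (trans (cong (_+ 1) (sym (^-identityʳ n))) (sym (*-identityˡ _))))

-- The `+ 1` is for `n = 0` and `a = 0`, where the left side is 1 and the power on the right may be
-- 0.
n^-grows : ∀ n a b → n ^ a ≤ n ^ (a + b) + 1
n^-grows zero zero b = m≤n+m 1 _
n^-grows zero (suc a) b = z≤n
n^-grows (suc n) a b = ≤-trans (^-monoʳ-≤ (suc n) (m≤m+n a b)) (m≤m+n _ 1)

pb-+ : ∀ {g h} → PolynomiallyBounded g → PolynomiallyBounded h → PolynomiallyBounded (λ n → g n + h n)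
pb-+ (C , a , g≤) (D , b , h≤) = C * 2 + D * 2 , a + b , λ n → begin
    _                                                ≤⟨ +-mono-≤ (g≤ n) (h≤ n) ⟩
    C * (n ^ a + 1) + D * (n ^ b + 1)                ≤⟨ +-mono-≤ (*-monoʳ-≤ C (raise n a b)) (*-monoʳ-≤ D (raise′ n a b)) ⟩
    C * (2 * (n ^ (a + b) + 1)) + D * (2 * (n ^ (a + b) + 1))  ≡⟨ cong₂ _+_ (*-assoc C 2 _) (*-assoc D 2 _) ⟨
    C * 2 * (n ^ (a + b) + 1) + D * 2 * (n ^ (a + b) + 1)      ≡⟨ *-distribʳ-+ (n ^ (a + b) + 1) (C * 2) (D * 2) ⟨
    (C * 2 + D * 2) * (n ^ (a + b) + 1)              ∎
  where
  open ≤-Reasoning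
  raise : ∀ n a b → n ^ a + 1 ≤ 2 * (n ^ (a + b) + 1)
  raise n a b = +-mono-≤ (n^-grows n a b) (≤-trans (m≤n+m 1 _) (m≤m+n _ 0))
  raise′ : ∀ n a b → n ^ b + 1 ≤ 2 * (n ^ (a + b) + 1)
  raise′ n a b = subst (λ e → n ^ b + 1 ≤ 2 * (n ^ e + 1)) (+-comm b a) (raise n b a)

-- With x and y the two powers and p = x y, the product (x + 1)(y + 1) is p + x + y + 1. Both x and
-- y are at most p + 1, which gives 3 (p + 1) and hence the factor 3.
pb-* : ∀ {g h} → PolynomiallyBounded g → PolynomiallyBounded h → PolynomiallyBounded (λ n → g n * h n)
pb-* (C , a , g≤) (D , b , h≤) = C * D * 3 , a + b , λ n → begin
    _                                        ≤⟨ *-mono-≤ (g≤ n) (h≤ n) ⟩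
    C * (n ^ a + 1) * (D * (n ^ b + 1))      ≡⟨ expand C D (n ^ a) (n ^ b) ⟩
    C * D * (n ^ a * n ^ b + n ^ a + n ^ b + 1)
      ≡⟨ cong (λ p → C * D * (p + n ^ a + n ^ b + 1)) (^-distribˡ-+-* n a b) ⟨
    C * D * (n ^ (a + b) + n ^ a + n ^ b + 1)
      ≤⟨ *-monoʳ-≤ (C * D) (+-monoˡ-≤ 1 (+-mono-≤ (+-monoʳ-≤ (n ^ (a + b)) (n^-grows n a b))
           (subst (λ e → n ^ b ≤ n ^ e + 1) (+-comm b a) (n^-grows n b a)))) ⟩
    C * D * (n ^ (a + b) + (n ^ (a + b) + 1) + (n ^ (a + b) + 1) + 1)
      ≡⟨ collect (C * D) (n ^ (a + b)) ⟩
    C * D * 3 * (n ^ (a + b) + 1)            ∎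
  where
  open ≤-Reasoning
  open +-*-Solver
  expand : ∀ C D x y → C * (x + 1) * (D * (y + 1)) ≡ C * D * (x * y + x + y + 1)
  expand = solve 4 (λ C D x y → C :* (x :+ con 1) :* (D :* (y :+ con 1))
                              := C :* D :* (x :* y :+ x :+ y :+ con 1)) refl
  collect : ∀ K p → K * (p + (p + 1) + (p + 1) + 1) ≡ K * 3 * (p + 1)
  collect = solve 2 (λ K p → K :* (p :+ (p :+ con 1) :+ (p :+ con 1) :+ con 1)
                          := K :* con 3 :* (p :+ con 1)) refl

pb-double : ∀ {g} → PolynomiallyBounded g → PolynomiallyBounded (λ n → double (g n))
pb-double {g} pb = pb-≤ (λ n → ≤-reflexive (double≡+ (g n))) (pb-+ pb pb)

pb-poly : ∀ c e → PolynomiallyBounded (poly c e)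
pb-poly c e = c , e , λ n → ≤-reflexive (trans (cong (c * n ^ e +_) (sym (*-identityʳ c)))
                                               (sym (*-distribˡ-+ c (n ^ e) 1)))

-- Depth-first search

-- The index counts the alternatives already used up, so it needs one value beyond the positions of
-- `xs` for the case that none is left.
choose : ∀ {A : Set} (xs : List A) → Fin (suc (length xs)) → Maybe (A × Fin (suc (length xs)))
choose [] _ = nothing
choose (x ∷ xs) fz = just (x , fs fz)
choose (x ∷ xs) (fs i) = Maybe.map (λ (y , j) → y , fs j) (choose xs i)

choose-[] : ∀ {A : Set} (xs : List A) i → drop (toℕ i) xs ≡ [] → choose xs i ≡ nothing
choose-[] [] i eq = refl
choose-[] (x ∷ xs) (fs i) eq rewrite choose-[] xs i eq = refl

choose-∷ : ∀ {A : Set} (xs : List A) i {y ys} → drop (toℕ i) xs ≡ y ∷ ys →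
           ∃[ j ] choose xs i ≡ just (y , j) × drop (toℕ j) xs ≡ ys
choose-∷ (x ∷ xs) fz refl = fs fz , refl , refl
choose-∷ (x ∷ xs) (fs i) eq with choose-∷ xs i eq
... | j , eq₁ , eq₂ rewrite eq₁ = fs j , refl , eq₂

-- What inverting a move requires besides the overwritten symbol. `keep` covers staying put,
-- including a left move at the left end. `fromEdge` differs from `fromRight` because the blank
-- created at the right end must vanish on the way back instead of being pushed to the right.
data Undo : Set where
  keep fromLeft fromRight fromEdge : Undo

fin-Undo : Finite Undo
fin-Undo = record
  { elements = keep ∷ fromLeft ∷ fromRight ∷ fromEdge ∷ []
  ; complete = λ { keep → here refl ; fromLeft → there (here refl)
                 ; fromRight → there (there (here refl)) ; fromEdge → there (there (there (here refl))) } }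

module Search (M : NTM) where
  open NTM M using (Q; k; δ; succs; HaltsWithin; paths)

  -- A configuration's state and scanned symbol, with the number of its transitions already tried.
  Branch : Set
  Branch = Σ (Fin Q) λ q → Σ (Sym k) λ a → Fin (suc (length (δ q a)))

  data Symbol : Set where
    cell  : Sym k → Symbol
    trail : Branch → Undo → Symbol

  data Phase : Set where
    readInput moveLeft startUp        : Phase
    borrow restore                    : Branch → Phase
    goLeft goRight                    : Branch → Fin Q → Sym k → Phase
    descend                           : Branch → Undo → Fin Q → Sym k → Phase
    backtrack                         : Sym k → Phase
    undo                              : Branch → Undo → Sym k → Phase
    accept reject                     : Phase

  fin-Branch : Finite Branch
  fin-Branch = fin-Σ fin-Fin λ _ → fin-Σ fin-Fin λ _ → fin-Fin

  fin-Symbol : Finite Symbol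
  fin-Symbol = fin-cover
    ((_ , fin-Fin , cell) ∷ (_ , fin-× fin-Branch fin-Undo , λ (e , u) → trail e u) ∷ [])
    λ { (cell a) → here (a , refl) ; (trail e u) → there (here ((e , u) , refl)) }

  fin-Phase : Finite Phase
  fin-Phase = fin-cover
    ( (_ , fin-⊤ , λ _ → readInput) ∷ (_ , fin-⊤ , λ _ → moveLeft) ∷ (_ , fin-⊤ , λ _ → startUp)
    ∷ (_ , fin-⊤ , λ _ → accept) ∷ (_ , fin-⊤ , λ _ → reject)
    ∷ (_ , fin-Branch , borrow) ∷ (_ , fin-Branch , restore) ∷ (_ , fin-Fin , backtrack)
    ∷ (_ , fin-× fin-Branch (fin-× fin-Fin fin-Fin) , λ (e , q , a) → goLeft e q a)
    ∷ (_ , fin-× fin-Branch (fin-× fin-Fin fin-Fin) , λ (e , q , a) → goRight e q a)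
    ∷ (_ , fin-× fin-Branch (fin-× fin-Undo (fin-× fin-Fin fin-Fin)) , λ (e , u , q , a) → descend e u q a)
    ∷ (_ , fin-× fin-Branch (fin-× fin-Undo fin-Fin) , λ (e , u , a) → undo e u a) ∷ [])
    λ { readInput → here (_ , refl)
      ; moveLeft → there (here (_ , refl))
      ; startUp → there (there (here (_ , refl)))
      ; accept → there (there (there (here (_ , refl))))
      ; reject → there (there (there (there (here (_ , refl)))))
      ; (borrow e) → there (there (there (there (there (here (e , refl))))))
      ; (restore e) → there (there (there (there (there (there (here (e , refl)))))))
      ; (backtrack a) → there (there (there (there (there (there (there (here (a , refl))))))))
      ; (goLeft e q a) →
          there (there (there (there (there (there (there (there (here ((e , q , a) , refl)))))))))
      ; (goRight e q a) →
          there (there (there (there (there (there (there (there (there (here ((e , q , a) , refl))))))))))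
      ; (descend e u q a) →
          there (there (there (there (there (there (there (there (there (there
            (here ((e , u , q , a) , refl)))))))))))
      ; (undo e u a) →
          there (there (there (there (there (there (there (there (there (there (there
            (here ((e , u , a) , refl)))))))))))) }

  pattern counter = fz
  pattern leftward = fs fz
  pattern rightward = fs (fs fz)
  pattern history = fs (fs (fs fz))
  pattern spare   = fs (fs (fs (fs fz)))

  Control : Set
  Control = Maybe (Fin 5 × Symbol) × Phase

  follow : Branch → Fin Q × Sym k × Move → Phase
  follow e (q , a , S) = descend e keep q a
  follow e (q , a , L) = goLeft e q a
  follow e (q , a , R) = goRight e q a

  takeNext : Branch → Phase
  takeNext (q , a , i) with choose (δ q a) i
  ... | nothing = backtrack a
  ... | just (tr , j) = follow (q , a , j) tr

  -- Payment is asked for only once another alternative is known to exist, so returning from the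
  -- last alternative of a node is free.
  payNext : Branch → Phase
  payNext (q , a , i) with choose (δ q a) i
  ... | nothing = backtrack a
  ... | just _ = borrow (q , a , i)

  visit : Fin Q → Sym k → Phase
  visit q a = takeNext (q , a , fz)

  source : Phase → Fin 5
  source readInput = counter
  source moveLeft = leftward
  source startUp = rightward
  source (borrow _) = counter
  source (restore _) = spare
  source (goLeft _ _ _) = leftward
  source (goRight _ _ _) = rightward
  -- This step has nothing to read, and `spare` is empty except during a decrement.
  source (descend _ _ _ _) = spare
  source (backtrack _) = history
  source (undo _ fromLeft _) = rightward
  source (undo _ _ _) = leftward
  source accept = spare
  source reject = spare

  control : Phase → Maybe Symbol → Control
  -- Stack 0 is both input and counter: once `x` and the separator are gone, what remains is the
  -- numeral of s(n) with its low bit on top. The bits of `x` now lie reversed on `leftward`, and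
  -- `moveLeft` restores their order.
  control readInput (just (cell (fs (fs (fs fz))))) = nothing , moveLeft
  control readInput (just a) = just (leftward , a) , readInput
  control moveLeft (just a) = just (rightward , a) , moveLeft
  control moveLeft nothing = nothing , startUp
  control startUp (just (cell a)) = nothing , visit (NTM.start M) a
  control startUp nothing = nothing , visit (NTM.start M) blank
  -- Binary decrement: low zeros become ones, parked on `spare`, until a one is found and cleared.
  control (borrow e) (just (cell (fs fz))) = just (spare , cell (bitSym true)) , borrow e
  control (borrow e) (just (cell (fs (fs fz)))) = just (counter , cell (bitSym false)) , restore e
  control (restore e) (just b) = just (counter , b) , restore e
  control (restore e) nothing = nothing , takeNext e
  control (goLeft e q a) nothing = nothing , descend e keep q a
  control (goLeft e q a) (just (cell b)) = just (rightward , cell a) , descend e fromLeft q b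
  control (goRight e q a) nothing = just (leftward , cell a) , descend e fromEdge q blank
  control (goRight e q a) (just (cell b)) = just (leftward , cell a) , descend e fromRight q b
  control (descend e u q a) _ = just (history , trail e u) , visit q a
  control (backtrack a) nothing = nothing , accept
  control (backtrack a) (just (trail e keep)) = nothing , payNext e
  control (backtrack a) (just (trail e u)) = nothing , undo e u a
  control (undo e fromLeft a) _ = just (leftward , cell a) , payNext e
  control (undo e fromRight a) _ = just (rightward , cell a) , payNext e
  control (undo e _ a) _ = nothing , payNext e
  -- This clause includes `borrow` on an empty counter, the one way in which the search rejects.
  control _ _ = nothing , reject

  halted : Phase → Bool
  halted accept = true
  halted reject = true
  halted _ = false

  accepting : Phase → Bool
  accepting accept = true
  accepting _ = false

  searcher : StackMachine
  searcher = record
    { State = Phase ; Symbol = Symbol ; finState = fin-Phase ; finSymbol = fin-Symbol ; K = 4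
    ; start = readInput ; bitSymbol = λ b → cell (bitSym b) ; sepSymbol = cell sepSym
    ; halted = halted ; source = source ; control = control ; accepting = accepting }

  open StackMachine searcher using (Reach; done; step; reach-≤; reach-++; Bounded; Stacks; cost; compile; Runs)

  -- Decrementing the counter

  digits : List Bool → List Symbol
  digits = map (λ b → cell (bitSym b))

  stacks : List Bool → List (Sym k) → List (Sym k) → List Symbol → List Bool → Stacks
  stacks n l r h s = digits n ∷ map cell l ∷ map cell r ∷ h ∷ digits s ∷ []

  -- Counter and spare are bounded jointly: a decrement moves bits back and forth between them, and
  -- only the total is invariant.
  record Small (H : ℕ) (n : List Bool) (l r : List (Sym k)) (h : List Symbol) (s : List Bool) : Set where
    constructor small
    field
      digits≤  : length s + length n ≤ H
      left≤    : length l ≤ H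
      right≤   : length r ≤ H
      history≤ : length h ≤ H

  bounded : ∀ {H n l r h s} → Small H n l r h s → Bounded H (stacks n l r h s)
  bounded {n = n} {l} {r} {h} {s} (small d≤ l≤ r≤ h≤) =
    length-map≤ n (m+n≤o⇒n≤o (length s) d≤) ∷ length-map≤ l l≤
    ∷ length-map≤ r r≤ ∷ h≤ ∷ length-map≤ s (m+n≤o⇒m≤o (length s) d≤) ∷ []
    where
    open VecAll using ([]; _∷_)
    length-map≤ : ∀ {A B : Set} {f : A → B} {H} xs → length xs ≤ H → length (map f xs) ≤ H
    length-map≤ {f = f} xs = subst (_≤ _) (sym (length-map f xs))

  unspare : ∀ {H b b′ n l r h s} → Small H n l r h (b ∷ s) → Small H (b′ ∷ n) l r h s
  unspare {s = s} (small d≤ l≤ r≤ h≤) = small (≤-trans (≤-reflexive (+-suc (length s) _)) d≤) l≤ r≤ h≤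

  spared : ∀ {H b b′ n l r h s} → Small H (b ∷ n) l r h s → Small H n l r h (b′ ∷ s)
  spared {s = s} (small d≤ l≤ r≤ h≤) = small (≤-trans (≤-reflexive (sym (+-suc (length s) _))) d≤) l≤ r≤ h≤

  restore-reach : ∀ {H n l r h} s e → Small H n l r h s →
    Reach H (suc (length s)) (restore e , stacks n l r h s) (takeNext e , stacks (s ʳ++ n) l r h [])
  restore-reach [] e sm = step refl (bounded sm) done
  restore-reach (b ∷ s) e sm = step refl (bounded sm) (restore-reach s e (unspare sm))

  data Borrow (H : ℕ) (n : List Bool) (l r : List (Sym k)) (h : List Symbol) (s : List Bool) (e : Branch) : Set where
    paid : ∀ n′ → suc (val n′) ≡ val n → length n′ ≡ length n →
           Reach H (length s + double (suc (length n))) (borrow e , stacks n l r h s)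
             (takeNext e , stacks (s ʳ++ n′) l r h []) → Borrow H n l r h s e
    broke : ∀ σ → val n ≡ 0 → Reach H (suc (length n)) (borrow e , stacks n l r h s) (reject , σ) →
            Borrow H n l r h s e

  -- The spare `s` is arbitrary because the recursion parks a bit there for every low zero. Leading
  -- zeros are never trimmed, so payments keep the length of the counter.
  borrow-reach : ∀ {H l r h} n s e → Small H n l r h s → Borrow H n l r h s e
  borrow-reach [] s e sm = broke _ refl (step refl (bounded sm) done)
  borrow-reach (true ∷ n) s e sm = paid (false ∷ n) refl refl
    (reach-≤ (≤-trans (≤-reflexive (+-comm 2 (length s)))
                      (+-monoʳ-≤ (length s) {2} {double (2 + length n)} (s≤s (s≤s z≤n))))
       (step refl (bounded sm) (restore-reach s e (unspare (spared {b′ = true} sm)))))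
  borrow-reach (false ∷ n) s e sm with borrow-reach n (true ∷ s) e (spared sm)
  ... | paid n′ eq len r = paid (true ∷ n′) (trans (sym (*-suc 2 (val n′))) (cong (2 *_) eq)) (cong suc len)
          (reach-≤ (≤-reflexive (sym (trans (+-suc (length s) _) (cong suc (+-suc (length s) _)))))
             (step refl (bounded sm) r))
  ... | broke σ eq r = broke σ (cong (2 *_) eq) (step refl (bounded sm) r)

  takeNext-follow : ∀ {q a i tr j} → choose (δ q a) i ≡ just (tr , j) → takeNext (q , a , i) ≡ follow (q , a , j) tr
  takeNext-follow eq rewrite eq = refl

  takeNext-backtrack : ∀ {q a i} → choose (δ q a) i ≡ nothing → takeNext (q , a , i) ≡ backtrack a
  takeNext-backtrack eq rewrite eq = refl

  payNext-borrow : ∀ {q a i x} → choose (δ q a) i ≡ just x → payNext (q , a , i) ≡ borrow (q , a , i)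
  payNext-borrow eq rewrite eq = refl

  payNext-backtrack : ∀ {q a i} → choose (δ q a) i ≡ nothing → payNext (q , a , i) ≡ backtrack a
  payNext-backtrack eq rewrite eq = refl

  -- Making and undoing one move

  open Config hiding (head)

  apply-left≤ : ∀ (c : Config Q k) tr → length (left (apply c tr)) ≤ suc (length (left c))
  apply-left≤ (conf _ l _ _) (_ , _ , S) = n≤1+n _
  apply-left≤ (conf _ [] _ _) (_ , _ , L) = z≤n
  apply-left≤ (conf _ (_ ∷ _) _ _) (_ , _ , L) = ≤-trans (n≤1+n _) (n≤1+n _)
  apply-left≤ (conf _ _ _ []) (_ , _ , R) = ≤-refl
  apply-left≤ (conf _ _ _ (_ ∷ _)) (_ , _ , R) = ≤-refl

  apply-right≤ : ∀ (c : Config Q k) tr → length (right (apply c tr)) ≤ suc (length (right c))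
  apply-right≤ (conf _ _ _ r) (_ , _ , S) = n≤1+n _
  apply-right≤ (conf _ [] _ _) (_ , _ , L) = n≤1+n _
  apply-right≤ (conf _ (_ ∷ _) _ _) (_ , _ , L) = ≤-refl
  apply-right≤ (conf _ _ _ []) (_ , _ , R) = z≤n
  apply-right≤ (conf _ _ _ (_ ∷ _)) (_ , _ , R) = ≤-trans (n≤1+n _) (n≤1+n _)

  -- t is the number of further moves that must fit.
  record Room (H t : ℕ) (l r : List (Sym k)) (h : List Symbol) : Set where
    constructor room
    field
      left≤    : length l + t ≤ H
      right≤   : length r + t ≤ H
      history≤ : length h + t ≤ H

  Visits : Config Q k → List Bool → List Symbol → Phase × Stacks
  Visits (conf q l a r) n h = visit q a , stacks n l r h []

  -- The search of a subtree ends on the same tape and history with which it began; only the counter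
  -- may differ from `Visits`.
  Leaves : Config Q k → List Bool → List Symbol → Phase × Stacks
  Leaves (conf q l a r) n h = backtrack a , stacks n l r h []

  record Edge (H : ℕ) (c d : Config Q k) (h : List Symbol) (e : Branch) (p : Phase) : Set where
    field
      mark : Undo
      down : ∀ n → length n ≤ H →
             Reach H 2 (p , stacks n (left c) (right c) h []) (Visits d n (trail e mark ∷ h))
      up   : ∀ n → length n ≤ H →
             Reach H 2 (Leaves d n (trail e mark ∷ h)) (payNext e , stacks n (left c) (right c) h [])

  edge : ∀ {H t q l a r h} tr e → Room H (suc t) l r h →
         Edge H (conf q l a r) (apply (conf q l a r) tr) h e (follow e tr)
  edge {H} {t} {q} {l} {a} {r} {h} tr e (room l≤ r≤ h≤) = go tr l r (fits {xs = l} l≤) (fits {xs = r} r≤)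
    where
    fits : ∀ {A : Set} {xs : List A} → length xs + suc t ≤ H → suc (length xs) ≤ H
    fits {xs = xs} le = ≤-trans (subst (suc (length xs) ≤_) (sym (+-suc (length xs) t)) (s≤s (m≤m+n _ t))) le
    ok : ∀ {n l r h′} → length n ≤ H → length l ≤ H → length r ≤ H → length h′ ≤ H → Bounded H (stacks n l r h′ [])
    ok n≤ l≤ r≤ h≤ = bounded (small n≤ l≤ r≤ h≤)
    h< : suc (length h) ≤ H
    h< = fits {xs = h} h≤
    h≤H : length h ≤ H
    h≤H = <⇒≤ h<
    go : ∀ tr l r → suc (length l) ≤ H → suc (length r) ≤ H →
         Edge H (conf q l a r) (apply (conf q l a r) tr) h e (follow e tr)
    go (q′ , b , S) l r l< r< = record
      { mark = keep
      ; down = λ n n≤ → step refl (ok n≤ (<⇒≤ l<) (<⇒≤ r<) h≤H) done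
      ; up = λ n n≤ → step refl (ok n≤ (<⇒≤ l<) (<⇒≤ r<) h<) done }
    go (q′ , b , L) [] r l< r< = record
      { mark = keep
      ; down = λ n n≤ → step refl (ok n≤ z≤n (<⇒≤ r<) h≤H) (step refl (ok n≤ z≤n (<⇒≤ r<) h≤H) done)
      ; up = λ n n≤ → step refl (ok n≤ z≤n (<⇒≤ r<) h<) done }
    go (q′ , b , L) (c ∷ l) r l< r< = record
      { mark = fromLeft
      ; down = λ n n≤ → step refl (ok n≤ (<⇒≤ l<) (<⇒≤ r<) h≤H)
                         (step refl (ok n≤ (<⇒≤ (<⇒≤ l<)) r< h≤H) done)
      ; up = λ n n≤ → step refl (ok n≤ (<⇒≤ (<⇒≤ l<)) r< h<)
                         (step refl (ok n≤ (<⇒≤ (<⇒≤ l<)) r< h≤H) done) }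
    go (q′ , b , R) l [] l< r< = record
      { mark = fromEdge
      ; down = λ n n≤ → step refl (ok n≤ (<⇒≤ l<) z≤n h≤H) (step refl (ok n≤ l< z≤n h≤H) done)
      ; up = λ n n≤ → step refl (ok n≤ l< z≤n h<) (step refl (ok n≤ l< z≤n h≤H) done) }
    go (q′ , b , R) l (c ∷ r) l< r< = record
      { mark = fromRight
      ; down = λ n n≤ → step refl (ok n≤ (<⇒≤ l<) (<⇒≤ r<) h≤H)
                         (step refl (ok n≤ l< (<⇒≤ (<⇒≤ r<)) h≤H) done)
      ; up = λ n n≤ → step refl (ok n≤ l< (<⇒≤ (<⇒≤ r<)) h<)
                         (step refl (ok n≤ l< (<⇒≤ (<⇒≤ r<)) h≤H) done) }

  -- Counting leaves and charging time to them

  children : ℕ → Config Q k → List (Fin Q × Sym k × Move) → ℕ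
  children t c trs = sum (map (paths t) (map (apply c) trs))

  paths-leaf : ∀ t c → succs c ≡ [] → paths t c ≡ 1
  paths-leaf t c eq rewrite eq = refl

  paths-branch : ∀ t c {tr trs} → δ (state c) (Config.head c) ≡ tr ∷ trs → paths (suc t) c ≡ children t c (tr ∷ trs)
  paths-branch t c eq rewrite eq = refl

  paths-positive : ∀ t c → 1 ≤ paths t c
  paths-positive t c with succs c
  ... | [] = ≤-refl
  paths-positive zero c | _ ∷ _ = ≤-refl
  paths-positive (suc t) c | d ∷ _ = ≤-trans (paths-positive t d) (m≤m+n _ _)

  -- The search of N leaves with allowance val n, which pays for all leaves but one.
  data Outcome (H A N : ℕ) (c : Config Q k) (n : List Bool) (h : List Symbol) (s : Phase × Stacks) : Set where
    finished  : ∀ n′ → length n′ ≡ length n → val n′ + N ≡ suc (val n) →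
                Reach H (N * A) s (Leaves c n′ h) → Outcome H A N c n h s
    exhausted : ∀ σ → suc (val n) < N → Reach H (suc (val n) * A) s (reject , σ) → Outcome H A N c n h s

  -- Two steps down, two steps up, and a decrement of at most `double (suc H)` steps.
  edgeCost : ℕ → ℕ
  edgeCost H = 6 + double H

  -- At least one leaf lies below an edge, so raising the rate per leaf from `A` to `E + A` pays for
  -- the edge.
  amortise : ∀ {x E p A} → x ≤ E → 1 ≤ p → x + p * A ≤ p * (E + A)
  amortise {x} {E} {suc p} {A} x≤E _ = begin
    x + suc p * A               ≤⟨ +-monoˡ-≤ (suc p * A) (≤-trans x≤E (m≤m+n E (p * E))) ⟩
    suc p * E + suc p * A       ≡⟨ *-distribˡ-+ (suc p) E A ⟨
    suc p * (E + A)             ∎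
    where open ≤-Reasoning

  -- Here `p` is the number of leaves below the edge, searched at rate `A`; `B` is the payment
  -- before the next sibling; and `y` counts the sibling leaves, already at the rate `E + A` of the
  -- parent.
  edge-cost : ∀ B y {E p A} → 4 + B ≤ E → 1 ≤ p →
              2 + (p * A + 2) + (B + y * (E + A)) ≤ (p + y) * (E + A)
  edge-cost B y {E} {p} {A} B≤ p≥1 = begin
    2 + (p * A + 2) + (B + y * (E + A))   ≡⟨ regroup (p * A) B (y * (E + A)) ⟩
    4 + B + p * A + y * (E + A)           ≤⟨ +-monoˡ-≤ (y * (E + A)) (amortise {4 + B} {E} {p} {A} B≤ p≥1) ⟩
    p * (E + A) + y * (E + A)             ≡⟨ *-distribʳ-+ (E + A) p y ⟨
    (p + y) * (E + A)                     ∎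
    where
    open ≤-Reasoning
    regroup : ∀ x B y → 2 + (x + 2) + (B + y) ≡ 4 + B + x + y
    regroup = solve 3 (λ x B y → con 2 :+ (x :+ con 2) :+ (B :+ y) := con 4 :+ B :+ x :+ y) refl
      where open +-*-Solver

  mutual
    -- The rate `t * edgeCost H` is one edge cost for each of the at most `t` edges from here to a
    -- leaf. If the allowance runs out, it is multiplied by the leaves reached, `suc (val n)`, and
    -- not by the possibly huge number of all leaves.
    explore : ∀ {H} t c n h → HaltsWithin t c → length n ≤ H → Room H t (left c) (right c) h →
              Outcome H (t * edgeCost H) (paths t c) c n h (Visits c n h)
    explore {H} t c n h halts n≤ rm = cases t halts rm (δ (state c) (Config.head c)) refl
      where
      cases : ∀ t → HaltsWithin t c → Room H t (left c) (right c) h → ∀ trs → δ (state c) (Config.head c) ≡ trs →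
              Outcome H (t * edgeCost H) (paths t c) c n h (Visits c n h)
      cases t _ _ [] eq
        rewrite paths-leaf t c (cong (map (apply c)) eq)
              | takeNext-backtrack {i = fz} (choose-[] (δ (state c) (Config.head c)) fz eq) =
        finished n refl (+-comm (val n) 1) done
      cases zero halts _ (tr ∷ trs) eq with trans (sym halts) (cong (map (apply c)) eq)
      ... | ()
      cases (suc t) halts rm (tr ∷ trs) eq rewrite paths-branch t c eq =
        search t c n h fz eq (subst (λ trs → All (HaltsWithin t) (map (apply c) trs)) eq halts) n≤ rm

    -- The same accounting for the alternatives still untried at a node. The next one is free here:
    -- it is either the first or has just been paid for.
    search : ∀ {H} t c n h i {tr trs} → drop (toℕ i) (δ (state c) (Config.head c)) ≡ tr ∷ trs →
             All (HaltsWithin t) (map (apply c) (tr ∷ trs)) → length n ≤ H →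
             Room H (suc t) (left c) (right c) h →
             Outcome H (suc t * edgeCost H) (children t c (tr ∷ trs)) c n h
               (takeNext (state c , Config.head c , i) , stacks n (left c) (right c) h [])
    search {H} t c n h i {tr} {trs} eq (halts All.∷ rest) n≤ rm@(room l≤ r≤ h≤)
      with choose-∷ (δ (state c) (Config.head c)) i eq
    ... | j , chosen , remaining
      rewrite takeNext-follow {i = i} chosen = first (explore t d n _ halts n≤ room′)
      where
      E A N : ℕ
      E = edgeCost H
      A = t * E
      d : Config Q k
      d = apply c tr
      N = paths t d
      e : Branch
      e = state c , Config.head c , j
      module ed = Edge (edge tr e rm)
      room′ : Room H t (left d) (right d) (trail e ed.mark ∷ h)
      room′ = room (≤-trans (+-monoˡ-≤ t (apply-left≤ c tr)) (≤-trans (≤-reflexive (sym (+-suc _ t))) l≤))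
                   (≤-trans (+-monoˡ-≤ t (apply-right≤ c tr)) (≤-trans (≤-reflexive (sym (+-suc _ t))) r≤))
                   (≤-trans (≤-reflexive (sym (+-suc _ t))) h≤)
      ts : List (Fin Q × Sym k × Move)
      ts = δ (state c) (Config.head c)
      N≥1 : 1 ≤ N
      N≥1 = paths-positive t d
      begun : Phase × Stacks
      begun = follow e tr , stacks n (left c) (right c) h []

      resume : ∀ n₁ → length n₁ ≡ length n → val n₁ + N ≡ suc (val n) →
               Reach H (2 + (N * A + 2)) begun (payNext e , stacks n₁ (left c) (right c) h []) →
               ∀ trs → drop (toℕ j) ts ≡ trs → All (HaltsWithin t) (map (apply c) trs) →
               Outcome H (E + A) (N + children t c trs) c n h begun
      resume n₁ len₁ eq₁ r [] none _ =
        finished n₁ len₁ (trans (cong (val n₁ +_) (+-identityʳ N)) eq₁)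
          (subst (λ p → Reach H ((N + 0) * (E + A)) begun (p , stacks n₁ (left c) (right c) h []))
                 (payNext-backtrack {i = j} (choose-[] ts j none))
                 (reach-≤ (≤-trans (m≤m+n _ 0) (edge-cost 0 0 (s≤s (s≤s (s≤s (s≤s z≤n)))) N≥1)) r))
      resume n₁ len₁ eq₁ r (tr′ ∷ trs) more halts′ with choose-∷ ts j more
      ... | _ , chosen′ , _ = spend (borrow-reach n₁ [] e sm)
        where
        N′ : ℕ
        N′ = children t c (tr′ ∷ trs)
        n₁≤ : length n₁ ≤ H
        n₁≤ = subst (_≤ H) (sym len₁) n≤
        sm : Small H n₁ (left c) (right c) h []
        sm = small n₁≤ (m+n≤o⇒m≤o _ l≤) (m+n≤o⇒m≤o _ r≤) (m+n≤o⇒m≤o _ h≤)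
        affordable : 4 + double (suc (length n₁)) ≤ E
        affordable = +-monoʳ-≤ 6 (double-mono n₁≤)
        affordable′ : 4 + suc (length n₁) ≤ E
        affordable′ = ≤-trans
          (+-monoʳ-≤ 4 (≤-trans (m≤m+n _ _) (≤-reflexive (sym (double≡+ (suc (length n₁)))))))
          affordable
        r′ : Reach H (2 + (N * A + 2)) begun (borrow e , stacks n₁ (left c) (right c) h [])
        r′ = subst (λ p → Reach H (2 + (N * A + 2)) begun (p , stacks n₁ (left c) (right c) h []))
                   (payNext-borrow {i = j} chosen′) r
        spend : Borrow H n₁ (left c) (right c) h [] e → Outcome H (E + A) (N + N′) c n h begun
        -- With nothing left, the child just searched has exactly `suc (val n)` leaves, and the next
        -- sibling contributes at least one more.
        spend (broke σ v≡0 rb) =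
          exhausted σ
            (subst (_< N + N′) N≡ (≤-trans (≤-reflexive (+-comm 1 N))
              (+-monoʳ-≤ N (≤-trans (paths-positive t (apply c tr′)) (m≤m+n _ _)))))
            (reach-≤ (begin
                2 + (N * A + 2) + suc (length n₁)        ≤⟨ +-monoʳ-≤ (2 + (N * A + 2)) (m≤m+n _ 0) ⟩
                2 + (N * A + 2) + (suc (length n₁) + 0)  ≤⟨ edge-cost (suc (length n₁)) 0 affordable′ N≥1 ⟩
                (N + 0) * (E + A)                        ≡⟨ cong (_* (E + A)) (trans (+-identityʳ N) N≡) ⟩
                suc (val n) * (E + A)                    ∎)
              (reach-++ r′ rb))
          where
          open ≤-Reasoning
          N≡ : N ≡ suc (val n)
          N≡ = trans (cong (_+ N) (sym v≡0)) eq₁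
        -- The search of the siblings pays for all their leaves but one, and the unit just borrowed
        -- pays for that one.
        spend (paid n₂ eq₂ len₂ rb) with search t c n₂ h j more halts′ (subst (_≤ H) (sym len₂) n₁≤) rm
        ... | finished n₃ len₃ eq₃ r₃ =
          finished n₃ (trans len₃ (trans len₂ len₁)) (begin
              val n₃ + (N + N′)    ≡⟨ cong (val n₃ +_) (+-comm N N′) ⟩
              val n₃ + (N′ + N)    ≡⟨ +-assoc (val n₃) N′ N ⟨
              val n₃ + N′ + N      ≡⟨ cong (_+ N) (trans eq₃ eq₂) ⟩
              val n₁ + N           ≡⟨ eq₁ ⟩
              suc (val n)          ∎)
            (reach-≤ (edge-cost (double (suc (length n₁))) N′ affordable N≥1) (reach-++ r′ (reach-++ rb r₃)))
          where open ≡-Reasoning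
        ... | exhausted σ v<N′ r₃ =
          exhausted σ
            (subst (_< N + N′) N+v≡ (+-monoʳ-< N v<N′))
            (reach-≤ (≤-trans (edge-cost (double (suc (length n₁))) (suc (val n₂)) affordable N≥1)
                              (≤-reflexive (cong (_* (E + A)) N+v≡)))
              (reach-++ r′ (reach-++ rb r₃)))
          where
          N+v≡ : N + suc (val n₂) ≡ suc (val n)
          N+v≡ = trans (+-comm N _) (trans (cong (_+ N) eq₂) eq₁)

      first : Outcome H A N d n (trail e ed.mark ∷ h) (Visits d n (trail e ed.mark ∷ h)) →
              Outcome H (E + A) (N + children t c trs) c n h begun
      first (exhausted σ v<N r) =
        exhausted σ (≤-trans v<N (m≤m+n _ _))
          (reach-≤ (amortise {2} {E} {suc (val n)} {A} (s≤s (s≤s z≤n)) (s≤s z≤n)) (reach-++ (ed.down n n≤) r))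
      first (finished n₁ len₁ eq₁ r₁) =
        resume n₁ len₁ eq₁ (reach-++ (ed.down n n≤) (reach-++ r₁ (ed.up n₁ (subst (_≤ H) (sym len₁) n≤))))
          trs remaining rest

  -- Loading the input and reading off the verdict

  loaded : List Symbol → List Bool → List Bool → Stacks
  loaded n l r = n ∷ digits l ∷ digits r ∷ [] ∷ [] ∷ []

  bounded-loaded : ∀ {H n l r} → length n ≤ H → length l ≤ H → length r ≤ H → Bounded H (loaded n l r)
  bounded-loaded {l = l} {r} n≤ l≤ r≤ =
    n≤ ∷ ≤-trans (≤-reflexive (length-map _ l)) l≤ ∷ ≤-trans (≤-reflexive (length-map _ r)) r≤ ∷ z≤n ∷ z≤n ∷ []
    where open VecAll using ([]; _∷_)

  encoded : List Bool → List Bool → List Symbol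
  encoded x y = digits x ++ cell sepSym ∷ digits y

  read-reach : ∀ {H} x y l → length (encoded x y) + length l ≤ H →
    Reach H (suc (length x)) (readInput , loaded (encoded x y) l []) (moveLeft , loaded (digits y) (x ʳ++ l) [])
  read-reach [] y l fits =
    step refl (bounded-loaded (m+n≤o⇒m≤o _ fits) (m+n≤o⇒n≤o (length (encoded [] y)) fits) z≤n) done
  read-reach {H} (b ∷ x) y l fits = pass b (read-reach x y (b ∷ l) (≤-trans (≤-reflexive (+-suc _ (length l))) fits))
    where
    pass : ∀ b →
      Reach H (suc (length x)) (readInput , loaded (encoded x y) (b ∷ l) [])
                               (moveLeft , loaded (digits y) (x ʳ++ b ∷ l) []) →
      Reach H (suc (suc (length x))) (readInput , loaded (encoded (b ∷ x) y) l [])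
                                     (moveLeft , loaded (digits y) (x ʳ++ b ∷ l) [])
    pass b r with bounded-loaded {n = encoded (b ∷ x) y} {l} {[]} (m+n≤o⇒m≤o _ fits)
                    (m+n≤o⇒n≤o (length (encoded (b ∷ x) y)) fits) z≤n
    pass true r | bnd = step refl bnd r
    pass false r | bnd = step refl bnd r

  move-reach : ∀ {H n} l r → length n ≤ H → length l + length r ≤ H →
    Reach H (suc (length l)) (moveLeft , loaded n l r) (startUp , loaded n [] (l ʳ++ r))
  move-reach [] r n≤ fits = step refl (bounded-loaded n≤ z≤n fits) done
  move-reach (b ∷ l) r n≤ fits =
    step refl (bounded-loaded n≤ (m+n≤o⇒m≤o _ fits) (m+n≤o⇒n≤o (suc (length l)) fits))
      (move-reach l (b ∷ r) n≤ (≤-trans (≤-reflexive (+-suc (length l) _)) fits))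

  start-reach : ∀ {H} x y → length (digits y) ≤ H → length x ≤ H →
    Reach H 1 (startUp , loaded (digits y) [] x) (Visits (NTM.init M x) y [])
  start-reach [] y y≤ x≤ = step refl (bounded-loaded y≤ z≤n x≤) done
  start-reach (b ∷ x) y y≤ x≤ = step refl (bounded-loaded {r = b ∷ x} y≤ z≤n x≤)
    (subst (λ r → Reach _ 0 (visit (NTM.start M) (bitSym b) , loaded (digits y) [] x)
                       (visit (NTM.start M) (bitSym b) , digits y ∷ [] ∷ r ∷ [] ∷ [] ∷ [])) (map-∘ x) done)

  load-reach : ∀ {H} x y → length (encoded x y) ≤ H →
    Reach H (suc (length x) + (suc (length x) + 1)) (readInput , loaded (encoded x y) [] [])
                                                    (Visits (NTM.init M x) y [])
  load-reach {H} x y fits =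
    reach-++ (read-reach x y [] (≤-trans (≤-reflexive (+-identityʳ _)) fits))
      (reach-++ (subst₂ (λ m x′ → Reach H (suc m) (moveLeft , loaded (digits y) (reverse x) [])
                                               (startUp , loaded (digits y) [] x′))
                        (length-reverse x) (reverse-involutive x)
                        (move-reach (reverse x) [] y≤
                          (≤-trans (≤-reflexive (trans (+-identityʳ _) (length-reverse x))) x≤)))
                (start-reach x y y≤ x≤))
    where
    len : length (encoded x y) ≡ length x + suc (length (digits y))
    len = trans (length-++ (digits x)) (cong (_+ suc (length (digits y))) (length-map _ x))
    both : length x + suc (length (digits y)) ≤ H
    both = ≤-trans (≤-reflexive (sym len)) fits
    y≤ : length (digits y) ≤ H
    y≤ = <⇒≤ (m+n≤o⇒n≤o (length x) both)
    x≤ : length x ≤ H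
    x≤ = m+n≤o⇒m≤o _ both

  -- Two passes over the input and the start step, then at most `suc v` leaves, then one step that
  -- finds the history empty.
  searchTime : ℕ → ℕ → ℕ → ℕ → ℕ
  searchTime H t n v = suc n + (suc n + 1) + (suc v * (t * edgeCost H) + 1)

  -- `N` counts all leaves, which is f(x) + 1 in the application; hence the successor on the
  -- allowance.
  record Verdict (H τ : ℕ) (x y : List Bool) (N : ℕ) : Set where
    field
      final    : Phase
      contents : Stacks
      stops    : halted final ≡ true
      soundness   : accepting final ≡ true → N ≤ suc (val y)
      completeness : N ≤ suc (val y) → accepting final ≡ true
      reaches  : Reach H τ (readInput , loaded (encoded x y) [] []) (final , contents)

  verdict : ∀ {H} t x y → HaltsWithin t (NTM.init M x) → length x + suc (length y) + t ≤ H →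
            Verdict H (searchTime H t (length x) (val y)) x y (paths t (NTM.init M x))
  verdict {H} t x y halts fits = conclude (explore t c y [] halts (≤-trans y≤ H≥) rm)
    where
    c : Config Q k
    c = NTM.init M x
    H≥ : length x + suc (length y) ≤ H
    H≥ = m+n≤o⇒m≤o _ fits
    y≤ : length y ≤ length x + suc (length y)
    y≤ = ≤-trans (n≤1+n _) (m≤n+m _ (length x))
    left-init : ∀ (w : List (Sym k)) → length (left (initConf (NTM.start M) w)) ≡ 0
    left-init [] = refl
    left-init (_ ∷ _) = refl
    right-init : ∀ (w : List (Sym k)) → length (right (initConf (NTM.start M) w)) ≤ length w
    right-init [] = z≤n
    right-init (_ ∷ w) = n≤1+n (length w)
    rm : Room H t (left c) (right c) []
    rm = room (≤-trans (+-monoˡ-≤ t (≤-trans (≤-reflexive (left-init (bits x))) z≤n)) fits)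
              (≤-trans (+-monoˡ-≤ t (≤-trans (right-init (bits x))
                (≤-trans (≤-reflexive (length-map _ x)) (m≤m+n _ _)))) fits)
              (≤-trans (m≤n+m t _) fits)
    loading : Reach H (suc (length x) + (suc (length x) + 1)) (readInput , loaded (encoded x y) [] []) (Visits c y [])
    loading = load-reach x y (≤-trans (≤-reflexive
      (trans (length-++ (digits x)) (cong₂ _+_ (length-map _ x) (cong suc (length-map _ y))))) H≥)
    conclude : Outcome H (t * edgeCost H) (paths t c) c y [] (Visits c y []) →
               Verdict H (searchTime H t (length x) (val y)) x y (paths t c)
    conclude (finished n len eq r) = record
      { final = accept ; contents = _ ; stops = refl
      ; soundness = λ _ → N≤ ; completeness = λ _ → refl
      ; reaches = reach-++ loading
          (reach-≤ (+-monoˡ-≤ 1 (*-monoˡ-≤ (t * edgeCost H) N≤))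
            (reach-++ r (step refl (bounded (small (≤-trans (≤-reflexive len) (≤-trans y≤ H≥))
              (m+n≤o⇒m≤o _ (Room.left≤ rm)) (m+n≤o⇒m≤o _ (Room.right≤ rm)) z≤n)) (done {n = 0})))) }
      where
      N≤ : paths t c ≤ suc (val y)
      N≤ = ≤-trans (m≤n+m _ (val n)) (≤-reflexive eq)
    conclude (exhausted σ v<N r) = record
      { final = reject ; contents = σ ; stops = refl
      ; soundness = λ () ; completeness = λ N≤ → contradiction N≤ (<⇒≱ v<N)
      ; reaches = reach-++ loading (reach-≤ (m≤m+n _ 1) r) }

  -- The overall time bound and the decision procedure

  module Decision (f : List Bool → ℕ) (s : ℕ → ℕ) (s>0 : ∀ n → 0 < s n) (c e C : ℕ)
                  (halts : ∀ x → HaltsWithin (poly c e (length x)) (NTM.init M x))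
                  (counts : ∀ x → paths (poly c e (length x)) (NTM.init M x) ≡ suc (f x))
                  (s<2^ : ∀ n → s n < 2 ^ (n + C)) where

    depth height base overhead : ℕ → ℕ
    depth n = poly c e n
    -- Room for `x`, the separator and a numeral of at most `n + C` bits, plus one cell for each
    -- move along a path.
    height n = n + suc (n + C) + depth n
    base n = suc n + (suc n + 1) + (2 * (depth n * edgeCost (height n)) + 1)
    overhead n = suc (base n * cost (height n))

    time : ℕ → ℕ → ℕ
    time n v = suc (searchTime (height n) (depth n) n v * cost (height n))

    pb-overhead : PolynomiallyBounded overhead
    pb-overhead = pb-suc (pb-* pb-base (pb-+ (pb-suc (pb-double pb-height)) (pb-suc (pb-suc (pb-double pb-height)))))
      where
      pb-suc : ∀ {g} → PolynomiallyBounded g → PolynomiallyBounded (λ n → suc (g n))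
      pb-suc = pb-+ (pb-const 1)
      pb-height : PolynomiallyBounded height
      pb-height = pb-+ (pb-+ pb-id (pb-suc (pb-+ pb-id (pb-const C)))) (pb-poly c e)
      pb-edgeCost : PolynomiallyBounded (λ n → edgeCost (height n))
      pb-edgeCost = pb-+ (pb-const 6) (pb-double pb-height)
      pb-base : PolynomiallyBounded base
      pb-base = pb-+ (pb-+ (pb-suc pb-id) (pb-+ (pb-suc pb-id) (pb-const 1)))
                     (pb-+ (pb-* (pb-const 2) (pb-* (pb-poly c e) pb-edgeCost)) (pb-const 1))

    -- Positivity makes `v` a factor of the whole bound: `suc v` leaves are at most `2 * v`, the
    -- source of the 2 in `base`, and the loading time is at most `v` times itself.
    searchTime≤ : ∀ n v → 0 < v → searchTime (height n) (depth n) n v ≤ v * base n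
    searchTime≤ n v@(suc u) _ = begin
      a + (suc v * A + 1)                        ≤⟨ +-monoʳ-≤ a (+-monoˡ-≤ 1 (*-monoˡ-≤ A (s≤s (s≤s (m≤n+m u u))))) ⟩
      a + ((2 + (u + u)) * A + 1)                ≤⟨ m≤m+n _ (u * (a + 1)) ⟩
      a + ((2 + (u + u)) * A + 1) + u * (a + 1)  ≡⟨ collect a A u ⟩
      v * (a + (2 * A + 1))                      ∎
      where
      open ≤-Reasoning
      a A : ℕ
      a = suc n + (suc n + 1)
      A = depth n * edgeCost (height n)
      collect : ∀ a A u → a + ((2 + (u + u)) * A + 1) + u * (a + 1) ≡ suc u * (a + (2 * A + 1))
      collect = solve 3 (λ a A u → a :+ ((con 2 :+ (u :+ u)) :* A :+ con 1) :+ u :* (a :+ con 1)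
                                := (con 1 :+ u) :* (a :+ (con 2 :* A :+ con 1))) refl
        where open +-*-Solver

    time≤ : ∀ n v → 0 < v → time n v ≤ v * overhead n
    time≤ n v v>0 = begin
      1 + searchTime (height n) (depth n) n v * cost (height n)
        ≤⟨ +-mono-≤ v>0 (*-monoˡ-≤ (cost (height n)) (searchTime≤ n v v>0)) ⟩
      v + v * base n * cost (height n)      ≡⟨ cong (v +_) (*-assoc v (base n) (cost (height n))) ⟩
      v + v * (base n * cost (height n))    ≡⟨ *-suc v (base n * cost (height n)) ⟨
      v * overhead n                        ∎
      where open ≤-Reasoning

    c′ e′ : ℕ
    c′ = proj₁ pb-overhead
    e′ = proj₁ (proj₂ pb-overhead)

    within : ∀ n {v} → v ≡ s n → time n v ≤ c′ * s n * (n ^ e′ + 1)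
    within n refl = begin
      time n (s n)                  ≤⟨ time≤ n (s n) (s>0 n) ⟩
      s n * overhead n              ≤⟨ *-monoʳ-≤ (s n) (proj₂ (proj₂ pb-overhead) n) ⟩
      s n * (c′ * (n ^ e′ + 1))     ≡⟨ *-assoc (s n) c′ (n ^ e′ + 1) ⟨
      s n * c′ * (n ^ e′ + 1)       ≡⟨ cong (_* (n ^ e′ + 1)) (*-comm (s n) c′) ⟩
      c′ * s n * (n ^ e′ + 1)       ∎
      where open ≤-Reasoning

    decides : DecidesInTime (proj₁ compile) f s c′ e′
    decides x = conclude (proj₂ compile x (s n) reaches stops)
      where
      n : ℕ
      n = length x
      y : List Bool
      y = binary (s n)
      val-y : val y ≡ s n
      val-y = val-binaryFuel (s n) (s n) ≤-refl
      fits : n + suc (length y) + depth n ≤ height n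
      fits = +-monoˡ-≤ (depth n) (+-monoʳ-≤ n (s≤s (binaryFuel-length (s n) (s n) (n + C) (s<2^ n))))
      open Verdict (verdict (depth n) x y (halts x) fits)
      conclude : Runs (proj₁ compile) final (time n (val y)) (encodePair x (s n)) →
                 Σ ℕ λ t → t ≤ c′ * s n * (n ^ e′ + 1) ×
                 Σ (Config (DTM.Q (proj₁ compile)) (DTM.k (proj₁ compile))) λ d →
                   (DTM.run (proj₁ compile) t (DTM.initW (proj₁ compile) (encodePair x (s n))) ≡ just d) ×
                   ((DTM.accept (proj₁ compile) (Config.state d) ≡ true → f x ≤ s n) ×
                    (f x ≤ s n → DTM.accept (proj₁ compile) (Config.state d) ≡ true))
      conclude (d , run≡ , accept≡) =
        time n (val y) , within n val-y , d , run≡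
        , (λ acc → s≤s⁻¹ (subst₂ _≤_ (counts x) (cong suc val-y) (soundness (trans (sym accept≡) acc))))
        , (λ f≤s → trans accept≡ (completeness (subst₂ _≤_ (sym (counts x)) (cong suc (sym val-y)) (s≤s f≤s))))

    decision : Σ DTM λ D → Σ ℕ λ c → Σ ℕ λ e → DecidesInTime D f s c e
    decision = proj₁ compile , c′ , e′ , decides

theorem2 : (f : List Bool → ℕ) → TotP f →
    (s : ℕ → ℕ) → ((n : ℕ) → 0 < s n) →
    (Σ ℕ λ c → Σ ℕ λ n₀ → (n : ℕ) → n₀ ≤ n → s n ≤ c * 2 ^ n) →
    Σ DTM λ D → Σ ℕ λ c → Σ ℕ λ e → DecidesInTime D f s c e
theorem2 f (M , c , e , halts , counts) s s>0 s=O[2^n] =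
  Search.Decision.decision M f s s>0 c e (proj₁ shift) halts counts (proj₂ shift)
  where
  shift : ∃[ C ] ∀ n → s n < 2 ^ (n + C)
  shift = exponential-shift s s=O[2^n]
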